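{- Let $S$ be a recurrent specular set on the finite alphabet $A$. For any nonempty $x\in S$, the set $\mathcal{R}_S(x)$ of right return words to $x$ in $S$ has $\mathrm{Card}(A)-1$ elements.
   Context: Words are over a finite alphabet $A$; $\varepsilon$ is the empty word. A set $S$ of words on $A$ is factorial if it contains $A$ and all the factors of its elements. For $w\in S$ let $L(w)=\{a\in A\mid aw\in S\}$, $R(w)=\{a\in A\mid wa\in S\}$, $B(w)=\{(a,b)\in A\times A\mid awb\in S\}$. A factorial set $S$ is biextendable if $B(w)\neq\emptyset$ for all $w\in S$. The extension graph $\mathcal{E}(w)$ is the undirected graph whose vertex set is the disjoint union of $L(w)$ and $R(w)$ and whose edges are the pairs in $B(w)$. A biextendable set $S$ is a tree set of characteristic $c$ if $\mathcal{E}(w)$ is a tree for every nonempty $w\in S$ and $\mathcal{E}(\varepsilon)$ is a disjoint union of $c$ trees. Let $\theta$ be an involution on $A$ (possibly with fixed points) and let $G_\theta$ be the group generated by $A$ with relations $a\theta(a)=1$, $a\in A$ (so $a^{ -1}=\theta(a)$). A word is reduced if it has no factor $a\theta(a)$ with $a\in A$; the inverse of a reduced word $a_1\cdots a_n$ is the reduced word $\theta(a_n)\cdots\theta(a_1)$. A laminary set on $A$ relative to $\theta$ is a biextendable set of reduced words closed under taking inverses. A specular set is a laminary set which is a tree set of characteristic $2$. A set $S\ne\{\varepsilon\}$ is recurrent if it is factorial and for all $u,w\in S$ there is $v\in S$ with $uvw\in S$. A complete return word to $x$ is a word of $S$ having $x$ as a proper prefix and as a proper suffix, and such that $x$ is not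 an internal factor of it ($v$ is an internal factor of $y$ if $y=uvw$ with $u,w$ nonempty). A right return word to $x$ in $S$ is a word $w$ such that $xw$ is a complete return word to $x$. -}

module Defs where

open import Data.Fin.Base using (Fin)
open import Data.List.Base using (List; []; _∷_; [_]; _++_; length; map; reverse)
open import Data.List.Membership.Propositional using (_∈_)
open import Data.List.Properties using (++-identityʳ)
open import Data.List.Relation.Unary.Linked using (Linked)
open import Data.List.Relation.Unary.Unique.Propositional using (Unique)
open import Data.Empty using (⊥)
open import Data.Nat.Base using (ℕ; _≤_)
open import Data.Product.Base using (Σ; ∃; ∃₂; _×_; _,_; proj₁; proj₂)
open import Data.Sum.Base using (_⊎_; inj₁; inj₂)
open import Function.Bundles using (_⇔_)
open import Level using (0ℓ)
open import Relation.Binary.Construct.Closure.ReflexiveTransitive using (Star)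
open import Relation.Binary.Core using (Rel)
open import Relation.Binary.Definitions using (Symmetric)
open import Relation.Binary.PropositionalEquality using (_≡_; _≢_; subst; sym; cong)
open import Relation.Nullary using (¬_)
open import Relation.Unary using (Pred; _≐_; ｛_｝)

-- The listing is by elements, so distinct proofs of P x are not counted
-- separately.
HasCard : {X : Set} → Pred X 0ℓ → ℕ → Set
HasCard {X} P n =
  Σ (List X) λ xs → Unique xs × length xs ≡ n × (∀ x → x ∈ xs ⇔ P x)

-- Simple undirected graphs.  Vertices form a subset of an ambient type V, and
-- Adj is used only up to inhabitation, so there are no multiple edges.
record Graph (V : Set) : Set₁ where
  field
    Vertex     : Pred V 0ℓ
    Adj        : Rel V 0ℓ
    adj-sym    : Symmetric Adj
    adj-irr    : ∀ {v} → ¬ Adj v v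
    adj-vertex : ∀ {u v} → Adj u v → Vertex u × Vertex v

module _ {V : Set} where

  induced : Graph V → Pred V 0ℓ → Graph V
  induced G P = record
    { Vertex     = λ v → Vertex v × P v
    ; Adj        = λ u v → Adj u v × P u × P v
    ; adj-sym    = λ { (e , p , q) → adj-sym e , q , p }
    ; adj-irr    = λ { (e , _) → adj-irr e }
    ; adj-vertex = λ { (e , p , q) →
        (proj₁ (adj-vertex e) , p) , (proj₂ (adj-vertex e) , q) }
    }
    where open Graph G

  module _ (G : Graph V) where
    open Graph G

    Connected : Set
    Connected = ∀ {u v} → Vertex u → Vertex v → Star Adj u v

    -- A cycle v, v₁, …, vₖ, v has k ≥ 2 and v, v₁, …, vₖ pairwise distinct.
    IsCycle : V → List V → Set
    IsCycle v vs = 2 ≤ length vs × Unique (v ∷ vs) × Linked Adj (v ∷ vs ++ [ v ])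

    Acyclic : Set
    Acyclic = ∀ v vs → ¬ IsCycle v vs

    record IsTree : Set where
      field
        nonempty  : ∃ Vertex
        connected : Connected
        acyclic   : Acyclic

  record IsDisjointUnionOfTrees (c : ℕ) (G : Graph V) : Set₁ where
    open Graph G
    field
      part     : Fin c → Pred V 0ℓ
      covers   : ∀ {v} → Vertex v → ∃ λ i → part i v
      disjoint : ∀ {v i j} → Vertex v → part i v → part j v → i ≡ j
      no-cross : ∀ {u v i} → Adj u v → part i u → part i v
      trees    : ∀ i → IsTree (induced G (part i))

module _ {A : Set} where

  Word : Set
  Word = List A

  InternalFactor : Word → Word → Set
  InternalFactor v y = ∃₂ λ u w → u ≢ [] × w ≢ [] × y ≡ u ++ v ++ w

  record Factorial (S : Pred Word 0ℓ) : Set where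
    field
      letters : ∀ a → S [ a ]
      factors : ∀ p u s → S (p ++ u ++ s) → S u

  module _ (S : Pred Word 0ℓ) where

    L : Word → Pred A 0ℓ
    L w a = S (a ∷ w)

    R : Word → Pred A 0ℓ
    R w b = S (w ++ [ b ])

    B : Word → Rel A 0ℓ
    B w a b = S (a ∷ w ++ [ b ])

    record Biextendable : Set where
      field
        factorial : Factorial S
        extend    : ∀ {w} → S w → ∃₂ λ a b → B w a b

    -- The disjoint union of L w and R w sits inside A ⊎ A.
    ExtVertex : Word → Pred (A ⊎ A) 0ℓ
    ExtVertex w (inj₁ a) = L w a
    ExtVertex w (inj₂ b) = R w b

    ExtAdj : Word → Rel (A ⊎ A) 0ℓ
    ExtAdj w (inj₁ a) (inj₂ b) = B w a b
    ExtAdj w (inj₂ b) (inj₁ a) = B w a b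
    ExtAdj w (inj₁ _) (inj₁ _) = ⊥
    ExtAdj w (inj₂ _) (inj₂ _) = ⊥

    extensionGraph : Factorial S → Word → Graph (A ⊎ A)
    extensionGraph fac w = record
      { Vertex     = ExtVertex w
      ; Adj        = ExtAdj w
      ; adj-sym    = λ {u} {v} → symm u v
      ; adj-irr    = λ {v} → irr v
      ; adj-vertex = λ {u} {v} → ends u v
      }
      where
      open Factorial fac

      symm : ∀ u v → ExtAdj w u v → ExtAdj w v u
      symm (inj₁ _) (inj₂ _) e = e
      symm (inj₂ _) (inj₁ _) e = e

      irr : ∀ v → ¬ ExtAdj w v v
      irr (inj₁ _) ()
      irr (inj₂ _) ()

      left : ∀ a b → B w a b → L w a
      left a b = factors [] (a ∷ w) [ b ]

      right : ∀ a b → B w a b → R w b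
      right a b e = factors [ a ] (w ++ [ b ]) []
        (subst S (cong (a ∷_) (sym (++-identityʳ (w ++ [ b ])))) e)

      ends : ∀ u v → ExtAdj w u v → ExtVertex w u × ExtVertex w v
      ends (inj₁ a) (inj₂ b) e = left a b e , right a b e
      ends (inj₂ b) (inj₁ a) e = right a b e , left a b e

    record TreeSet (c : ℕ) : Set₁ where
      field
        biextendable : Biextendable
      open Biextendable biextendable public
      field
        nonempty-tree : ∀ {w} → S w → w ≢ [] → IsTree (extensionGraph factorial w)
        empty-trees   : IsDisjointUnionOfTrees c (extensionGraph factorial [])

    record Recurrent : Set where
      field
        nontrivial : ¬ (S ≐ ｛ [] ｝)
        factorial  : Factorial S
        recur      : ∀ {u w} → S u → S w → ∃ λ v → S v × S (u ++ v ++ w)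

    record CompleteReturn (x y : Word) : Set where
      field
        member        : S y
        proper-prefix : ∃ λ s → s ≢ [] × y ≡ x ++ s
        proper-suffix : ∃ λ p → p ≢ [] × y ≡ p ++ x
        not-internal  : ¬ InternalFactor x y

    RightReturn : Word → Pred Word 0ℓ
    RightReturn x w = CompleteReturn x (x ++ w)

  module _ (θ : A → A) where

    Reduced : Pred Word 0ℓ
    Reduced w = ∀ p a s → w ≢ p ++ a ∷ θ a ∷ s

    inverse : Word → Word
    inverse w = reverse (map θ w)

    record Laminary (S : Pred Word 0ℓ) : Set where
      field
        biextendable   : Biextendable S
        reduced        : ∀ {w} → S w → Reduced w
        inverse-closed : ∀ {w} → S w → S (inverse w)

    record Specular (S : Pred Word 0ℓ) : Set₁ where
      field
        laminary : Laminary S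
        treeSet  : TreeSet S 2

{-# OPTIONS --safe #-}
module Submission where

open import Algebra.Definitions using (Involutive)
open import Algebra.Properties.CommutativeSemigroup using (interchange)
open import Data.Fin.Base using (Fin)
open import Data.Fin.Properties as Fin using (inj⇒≟)
open import Data.List.Base using (List; []; _∷_; [_]; _++_; _∷ʳ_; length; map; filter; take; drop; cartesianProductWith; allFin; _∷ʳ′_; initLast)
open import Data.List.Membership.Propositional using (_∈_; find; lose)
open import Data.List.Membership.Propositional.Properties using (∈-filter⁺; ∈-filter⁻; ∈-map⁺; ∈-map⁻; ∈-allFin; ∈-++⁺ˡ; ∈-++⁺ʳ; ∈-++⁻; ∈-cartesianProductWith⁺; ∈-cartesianProductWith⁻)
open import Data.List.Membership.Propositional.Properties.WithK using (unique∧set⇒bag)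
open import Data.List.Properties using (length-map; length-tabulate; length-++; length-++-sucʳ; length-++-≤ˡ; length-++-≤ʳ; length-take; take++drop≡id; ++-assoc; ++-identityʳ; ++-cancelˡ; ++-conicalʳ; ∷-injective; ∷-injectiveʳ; ∷ʳ-injective; ∷ʳ-injectiveˡ; ∷ʳ-++)
open import Data.List.Relation.Binary.BagAndSetEquality using (∼bag⇒↭)
open import Data.List.Relation.Binary.Infix.Heterogeneous as Infix using (Infix; _++ⁱ_; _ⁱ++_; here; there)
open import Data.List.Relation.Binary.Infix.Heterogeneous.Properties as Infix using (infix?)
open import Data.List.Relation.Binary.Permutation.Propositional.Properties using (↭-length)
open import Data.List.Relation.Binary.Pointwise using (Pointwise-≡⇒≡; ≡⇒Pointwise-≡)
open import Data.List.Relation.Binary.Prefix.Heterogeneous as Prefix using (Prefix; _++ᵖ_; []; _∷_)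
open import Data.List.Relation.Binary.Prefix.Heterogeneous.Properties as Prefix using (prefix?)
open import Data.List.Relation.Unary.All as All using (All; []; _∷_)
open import Data.List.Relation.Unary.AllPairs as AllPairs using (AllPairs; []; _∷_)
open import Data.List.Relation.Unary.AllPairs.Properties as AllPairsₚ using ()
open import Data.List.Relation.Unary.Any using (here; there; any?)
open import Data.List.Relation.Unary.Linked as Linked using (Linked; [-]; _∷_)
open import Data.List.Relation.Unary.Unique.Propositional using (Unique)
open import Data.List.Relation.Unary.Unique.Propositional.Properties as Unique using ()
open import Data.Nat.Base using (ℕ; zero; suc; _+_; _*_; _∸_; _≤_; _<_; z≤n; s≤s)
open import Data.Nat.ListAction using (sum)
open import Data.Nat.Properties using (+-assoc; +-comm; +-suc; +-identityʳ; +-cancelˡ-≡; +-commutativeSemigroup; *-assoc; *-identityˡ; *-zeroʳ; *-distribˡ-+; *-distribʳ-+; m+n∸n≡m; m+[n∸m]≡n; m∸n+n≡m; m≤n⇒m⊓n≡m; ≤-refl; ≤-reflexive; ≤-trans; ≤-pred; m≤m+n; m≤n+m; m<m+n; n≤1+n; m≤n⇒m≤1+n; m≤n⇒m<n∨m≡n; <⇒≱; ≰⇒>; 1+n≰n; _≤?_; module ≤-Reasoning)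
open import Data.Product.Base using (Σ; ∃; ∃₂; _×_; _,_; proj₁; proj₂; swap; map₂)
open import Data.Sum.Base using (_⊎_; inj₁; inj₂; [_,_]′)
open import Data.Sum.Properties using (inj₁-injective; inj₂-injective) renaming (≡-dec to ⊎-≡-dec)
open import Data.Unit.Base using (⊤; tt)
open import Function.Base using (_∘_; id)
open import Function.Bundles using (_↔_; _⇔_; mk⇔; Equivalence; Inverse)
open import Function.Properties.Inverse using (↔⇒↣)
open import Level using (0ℓ)
open import Relation.Binary.Construct.Closure.ReflexiveTransitive as Star using (Star; ε; _◅_; _◅◅_)
open import Relation.Binary.Core using (Rel; _⇒_)
open import Relation.Binary.Definitions using (DecidableEquality; Symmetric) renaming (Decidable to Decidable₂)
open import Relation.Binary.PropositionalEquality using (_≡_; _≢_; refl; sym; trans; cong; cong₂; subst; module ≡-Reasoning)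
open import Relation.Nullary using (¬_; Dec; yes; no; contradiction; ¬?; _×-dec_)
open import Relation.Nullary.Decidable using (map′)
open import Relation.Unary using (Pred; Decidable)
open import Defs

-- For w ∈ S let r(w) be the number of right extensions of w and ρ(w) = r(w) − χ(w), where χ(w) is
-- the number of trees of the extension graph.  A forest has χ fewer edges than vertices, so ρ(w)
-- is the sum of ρ(aw) over the left extensions aw of w.
--
-- Call a word of S avoiding if x does not occur in it, and rooted if its only occurrence of x is
-- as a prefix; write U(k) for the set of rooted words of length k, l(k) for the number of complete
-- returns of length k and E(k) for the sum of ρ over the avoiding words of length k.  Extending
-- avoiding words to the left and rooted words to the right gives
--   E(k) = E(k+1) + Σ_{U(k+1)} ρ   and   |U(k)| + Σ_{U(k)} ρ = |U(k+1)| + l(k+1)  (k ≥ |x|),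
-- so Q(k) = E(k) + |U(k+1)| loses exactly l(k+2) from k to k+1, starting from Card(A) − 2 + 1
-- at k = |x| − 1.  By recurrence every rooted word extends to a complete return, so Q keeps
-- decreasing until no rooted words are left.  Then, again by recurrence, Q = 0, and all
-- Card(A) − 1 complete returns have been counted.
--
-- Membership in S is decidable although this is not assumed: a simple path in a forest shows
-- whether its end points are adjacent.

-- Finite sums and cardinalities

∑ : {X : Set} → List X → (X → ℕ) → ℕ
∑ xs f = sum (map f xs)

module _ {X : Set} where

  ∑-cong-∈ : ∀ xs {f g : X → ℕ} → (∀ {x} → x ∈ xs → f x ≡ g x) → ∑ xs f ≡ ∑ xs g
  ∑-cong-∈ []       eq = refl
  ∑-cong-∈ (x ∷ xs) eq = cong₂ _+_ (eq (here refl)) (∑-cong-∈ xs (eq ∘ there))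

  ∑-cong : ∀ xs {f g : X → ℕ} → (∀ x → f x ≡ g x) → ∑ xs f ≡ ∑ xs g
  ∑-cong xs eq = ∑-cong-∈ xs (λ {x} _ → eq x)

  ∑-zero : ∀ xs {f : X → ℕ} → (∀ {x} → x ∈ xs → f x ≡ 0) → ∑ xs f ≡ 0
  ∑-zero []       eq = refl
  ∑-zero (x ∷ xs) eq = cong₂ _+_ (eq (here refl)) (∑-zero xs (eq ∘ there))

  ∑-+ : ∀ xs (f g : X → ℕ) → ∑ xs (λ x → f x + g x) ≡ ∑ xs f + ∑ xs g
  ∑-+ []       f g = refl
  ∑-+ (x ∷ xs) f g =
    trans (cong (f x + g x +_) (∑-+ xs f g)) (interchange +-commutativeSemigroup (f x) (g x) (∑ xs f) (∑ xs g))

  ∑-*ˡ : ∀ xs k (f : X → ℕ) → ∑ xs (λ x → k * f x) ≡ k * ∑ xs f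
  ∑-*ˡ []       k f = sym (*-zeroʳ k)
  ∑-*ˡ (x ∷ xs) k f =
    trans (cong (k * f x +_) (∑-*ˡ xs k f)) (sym (*-distribˡ-+ k (f x) (∑ xs f)))

  ∑-++ : ∀ xs ys (f : X → ℕ) → ∑ (xs ++ ys) f ≡ ∑ xs f + ∑ ys f
  ∑-++ []       ys f = refl
  ∑-++ (x ∷ xs) ys f =
    trans (cong (f x +_) (∑-++ xs ys f)) (sym (+-assoc (f x) (∑ xs f) (∑ ys f)))

  ∑-map : ∀ {Y : Set} (g : Y → X) ys (f : X → ℕ) → ∑ (map g ys) f ≡ ∑ ys (f ∘ g)
  ∑-map g []       f = refl
  ∑-map g (y ∷ ys) f = cong (f (g y) +_) (∑-map g ys f)

  ∈⇒≤∑ : ∀ {xs x} (f : X → ℕ) → x ∈ xs → f x ≤ ∑ xs f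
  ∈⇒≤∑ {y ∷ xs} f (here refl)  = m≤m+n (f y) (∑ xs f)
  ∈⇒≤∑ {y ∷ xs} f (there x∈xs) = ≤-trans (∈⇒≤∑ f x∈xs) (m≤n+m (∑ xs f) (f y))

∑-swap : ∀ {X Y : Set} xs ys (f : X → Y → ℕ) →
  ∑ xs (λ x → ∑ ys (f x)) ≡ ∑ ys (λ y → ∑ xs (λ x → f x y))
∑-swap []       ys f = sym (∑-zero ys (λ _ → refl))
∑-swap (x ∷ xs) ys f =
  trans (cong (∑ ys (f x) +_) (∑-swap xs ys f)) (sym (∑-+ ys (f x) _))

∑-cartesianProductWith : ∀ {X Y Z : Set} (g : X → Y → Z) xs ys (f : Z → ℕ) →
  ∑ (cartesianProductWith g xs ys) f ≡ ∑ xs (λ x → ∑ ys (λ y → f (g x y)))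
∑-cartesianProductWith g []       ys f = refl
∑-cartesianProductWith g (x ∷ xs) ys f =
  trans (∑-++ (map (g x) ys) _ f)
    (cong₂ _+_ (∑-map (g x) ys f) (∑-cartesianProductWith g xs ys f))

𝟙 : {P : Set} → Dec P → ℕ
𝟙 (yes _) = 1
𝟙 (no  _) = 0

module _ {P : Set} where

  𝟙-yes : (P? : Dec P) → P → 𝟙 P? ≡ 1
  𝟙-yes (yes _) p = refl
  𝟙-yes (no ¬p) p = contradiction p ¬p

  𝟙-no : (P? : Dec P) → ¬ P → 𝟙 P? ≡ 0
  𝟙-no (yes p) ¬p = contradiction p ¬p
  𝟙-no (no _)  ¬p = refl

𝟙-⊎ : ∀ {P Q R : Set} (R? : Dec R) (P? : Dec P) (Q? : Dec Q) →
  R ⇔ (P ⊎ Q) → ¬ (P × Q) → 𝟙 R? ≡ 𝟙 P? + 𝟙 Q?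
𝟙-⊎ R? (yes p) (yes q) R⇔ disj = contradiction (p , q) disj
𝟙-⊎ R? (yes p) (no ¬q) R⇔ disj = 𝟙-yes R? (Equivalence.from R⇔ (inj₁ p))
𝟙-⊎ R? (no ¬p) (yes q) R⇔ disj = 𝟙-yes R? (Equivalence.from R⇔ (inj₂ q))
𝟙-⊎ R? (no ¬p) (no ¬q) R⇔ disj = 𝟙-no R? ([ ¬p , ¬q ]′ ∘ Equivalence.to R⇔)

𝟙-× : ∀ {P Q R : Set} (R? : Dec R) (P? : Dec P) (Q? : Dec Q) →
  R ⇔ (P × Q) → 𝟙 R? ≡ 𝟙 P? * 𝟙 Q?
𝟙-× R? (yes p) (yes q) R⇔ = 𝟙-yes R? (Equivalence.from R⇔ (p , q))
𝟙-× R? (yes p) (no ¬q) R⇔ = 𝟙-no R? (¬q ∘ proj₂ ∘ Equivalence.to R⇔)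
𝟙-× R? (no ¬p) Q?      R⇔ = 𝟙-no R? (¬p ∘ proj₁ ∘ Equivalence.to R⇔)

-- Duplicate-free lists with the same elements are permutations of each other. Counting one
-- predicate in two ways thus gives an equation of numbers.
HasCard-unique : ∀ {X : Set} {P : Pred X 0ℓ} {m n} → HasCard P m → HasCard P n → m ≡ n
HasCard-unique (xs , !xs , refl , xs⇔) (ys , !ys , refl , ys⇔) =
  ↭-length (∼bag⇒↭ (unique∧set⇒bag !xs !ys (λ {x} → mk⇔
    (Equivalence.from (ys⇔ x) ∘ Equivalence.to (xs⇔ x))
    (Equivalence.from (xs⇔ x) ∘ Equivalence.to (ys⇔ x)))))

HasCard-resp-⇔ : ∀ {X : Set} {P Q : Pred X 0ℓ} {m} → (∀ x → P x ⇔ Q x) → HasCard P m → HasCard Q m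
HasCard-resp-⇔ P⇔Q (xs , !xs , len , xs⇔) = xs , !xs , len , λ x → mk⇔
  (Equivalence.to (P⇔Q x) ∘ Equivalence.to (xs⇔ x))
  (Equivalence.from (xs⇔ x) ∘ Equivalence.from (P⇔Q x))

All-image⇒map : ∀ {X Y : Set} (f : X → Y) {ys} → All (λ y → ∃ λ x → y ≡ f x) ys →
  ∃ λ xs → ys ≡ map f xs
All-image⇒map f []                = [] , refl
All-image⇒map f ((x , refl) ∷ ps) with xs , refl ← All-image⇒map f ps = x ∷ xs , refl

-- All elements of `P` being in the image, the list for `P` has the form `map f xs`; injectivity
-- then ensures that `xs` contains every preimage.
HasCard-preimage : ∀ {X Y : Set} {P : Pred Y 0ℓ} {m} (f : X → Y) →
  (∀ {x x′} → f x ≡ f x′ → x ≡ x′) → (∀ {y} → P y → ∃ λ x → y ≡ f x) →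
  HasCard P m → HasCard (P ∘ f) m
HasCard-preimage f inj onto (ys , !ys , len , ys⇔)
  with xs , refl ← All-image⇒map f (All.tabulate (λ {y} → onto ∘ Equivalence.to (ys⇔ y)))
  = xs , AllPairs.map (_∘ cong f) (AllPairsₚ.map⁻ !ys) , trans (sym (length-map f xs)) len
  , λ x → mk⇔ (Equivalence.to (ys⇔ (f x)) ∘ ∈-map⁺ f)
      (λ pfx → let x′ , x′∈xs , eq = ∈-map⁻ f (Equivalence.from (ys⇔ (f x)) pfx)
               in subst (_∈ xs) (sym (inj eq)) x′∈xs)

module _ {X : Set} {P : Pred X 0ℓ} (P? : Decidable P) where

  length-filter-∑ : ∀ xs → length (filter P? xs) ≡ ∑ xs (𝟙 ∘ P?)
  length-filter-∑ []       = refl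
  length-filter-∑ (x ∷ xs) with P? x
  ... | yes _ = cong suc (length-filter-∑ xs)
  ... | no  _ = length-filter-∑ xs

  ∑-HasCard : ∀ {xs} → Unique xs → HasCard (λ x → x ∈ xs × P x) (∑ xs (𝟙 ∘ P?))
  ∑-HasCard {xs} !xs =
    filter P? xs , Unique.filter⁺ P? !xs , length-filter-∑ xs ,
    λ x → mk⇔ (∈-filter⁻ P?) (λ (x∈xs , px) → ∈-filter⁺ P? x∈xs px)

  ∑-𝟙-unique : ∀ {xs y} → Unique xs → y ∈ xs → P y → (∀ {x} → x ∈ xs → P x → x ≡ y) →
    ∑ xs (𝟙 ∘ P?) ≡ 1
  ∑-𝟙-unique {xs} {y} !xs y∈xs py uniq = HasCard-unique (∑-HasCard !xs)
    ([ y ] , [] ∷ [] , refl , λ x → mk⇔ (λ { (here refl) → y∈xs , py }) (λ (x∈xs , px) → here (uniq x∈xs px)))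

-- Paths and forests

module _ {V : Set} where

  module _ {R : Rel V 0ℓ} where

    targets : ∀ {u v} → Star R u v → List V
    targets ε                 = []
    targets (_◅_ {j = w} _ p) = w ∷ targets p

    -- The larger relation `R′` leaves room for a closing edge that is not in `R`.
    closed-linked : ∀ {R′ : Rel V 0ℓ} → R ⇒ R′ → ∀ {u v z} (p : Star R u v) → R′ v z →
      Linked R′ (u ∷ targets p ++ [ z ])
    closed-linked f ε               e = e ∷ [-]
    closed-linked f (d ◅ ε)         e = f d ∷ e ∷ [-]
    closed-linked f (d ◅ p@(_ ◅ _)) e = f d ∷ closed-linked f p e

    SimplePath : V → V → Set
    SimplePath u v = Σ (Star R u v) λ p → Unique (u ∷ targets p)

    truncate : ∀ {u v w} (p : Star R w v) → Unique (w ∷ targets p) → u ∈ w ∷ targets p → SimplePath u v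
    truncate p       !p       (here refl) = p , !p
    truncate (e ◅ p) (_ ∷ !p) (there u∈)  = truncate p !p u∈

  module _ (_≟_ : DecidableEquality V) where

    open import Data.List.Membership.DecPropositional _≟_ using (_∈?_)

    -- Loop erasure: if the start `u` recurs on the simplified tail, everything before that
    -- recurrence is cut off.
    simplify : ∀ {R : Rel V 0ℓ} {u v} → Star R u v → SimplePath {R} u v
    simplify         ε       = ε , [] ∷ []
    simplify {u = u} (_◅_ {j = w} e p) with q , !q ← simplify p with u ∈? (w ∷ targets q)
    ... | yes u∈ = truncate q !q u∈
    ... | no  u∉ = e ◅ q , All.tabulate (λ z∈ u≡z → u∉ (subst (_∈ _) (sym u≡z) z∈)) ∷ !q

    module _ {G : Graph V} (acyclic : Acyclic G) where
      open Graph G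

      -- A simple path of length at least 2 together with an edge between its ends is a cycle.
      no-detour : ∀ {H : Rel V 0ℓ} → H ⇒ Adj → ∀ {u v} → Adj u v → ¬ H u v → ¬ Star H u v
      no-detour H⇒Adj uv ¬Huv p with simplify p
      ... | ε , _ = adj-irr uv
      ... | e ◅ ε , _ = ¬Huv e
      ... | d ◅ e ◅ q , !q = acyclic _ _ (s≤s (s≤s z≤n) , !q ,
              closed-linked H⇒Adj (d ◅ e ◅ q) (adj-sym uv))

      -- Loop erasure leaves three cases: equal end points, a single edge, or a longer simple path,
      -- which an edge between its ends would close to a cycle.
      connected⇒adj? : ∀ {u v} → Star Adj u v → Dec (Adj u v)
      connected⇒adj? p with simplify p
      ... | ε , _ = no adj-irr
      ... | e ◅ ε , _ = yes e
      ... | d ◅ e ◅ q , !q = no λ uv → acyclic _ _ (s≤s (s≤s z≤n) , !q ,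
              closed-linked id (d ◅ e ◅ q) (adj-sym uv))

  -- Lets nonempty words, with one tree, and the empty word, with `c` trees, share one counting
  -- argument.
  tree⇒disjointUnion : ∀ {G : Graph V} → IsTree G → IsDisjointUnionOfTrees 1 G
  tree⇒disjointUnion {G} t = record
    { part     = λ _ _ → ⊤
    ; covers   = λ _ → Fin.zero , tt
    ; disjoint = λ { {i = Fin.zero} {Fin.zero} _ _ _ → refl }
    ; no-cross = λ _ _ → tt
    ; trees    = λ _ → record
      { nonempty  = map₂ (_, tt) nonempty
      ; connected = λ (u , _) (v , _) → Star.map (_, (tt , tt)) (connected u v)
      ; acyclic   = λ v vs (len , uniq , link) → acyclic v vs (len , uniq , Linked.map proj₁ link)
      }
    }
    where open IsTree t

  module Forest {c} {G : Graph V} (forest : IsDisjointUnionOfTrees c G) where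
    open Graph G
    open IsDisjointUnionOfTrees forest

    part-Star : ∀ {u v i} → Star Adj u v → part i u → part i v
    part-Star ε       p = p
    part-Star (e ◅ q) p = part-Star q (no-cross e p)

    connected-part : ∀ {u v i} → Vertex u → Vertex v → part i u → part i v → Star Adj u v
    connected-part u v pu pv = Star.map proj₁ (IsTree.connected (trees _) (u , pu) (v , pv))

    -- No edge leaves a part, so a cycle stays in the part of its first vertex, which is a tree.
    acyclic : Acyclic G
    acyclic v [] (() , _)
    acyclic v vs@(_ ∷ _) (len , uniq , e ∷ link)
      with i , pv ← covers (proj₁ (adj-vertex e))
      = IsTree.acyclic (trees i) v vs (len , uniq , restrict pv (e ∷ link))
      where
      restrict : ∀ {u us} → part i u → Linked Adj (u ∷ us) →
                 Linked (Graph.Adj (induced G (part i))) (u ∷ us)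
      restrict pu [-]        = [-]
      restrict pu (e ∷ link) = (e , pu , no-cross e pu) ∷ restrict (no-cross e pu) link

    adj? : DecidableEquality V → ∀ {u v} → Vertex u → Vertex v → Dec (Adj u v)
    adj? _≟_ u v with i , pu ← covers u | j , pv ← covers v with i Fin.≟ j
    ... | yes refl = connected⇒adj? _≟_ {G} acyclic (connected-part u v pu pv)
    ... | no  i≢j  = no λ e → i≢j (disjoint v (no-cross e pu) pv)

  Vertex-Star : ∀ (G : Graph V) {u v} → Star (Graph.Adj G) u v → Graph.Vertex G u → Graph.Vertex G v
  Vertex-Star G ε       p = p
  Vertex-Star G (e ◅ q) p = Vertex-Star G q (proj₂ (Graph.adj-vertex G e))

  -- Union-find: rep picks a representative in each component of the graph spanned by the edges
  -- of G listed in es, and every edge of a forest merges two components.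
  module SpanningForest
    (_≟_ : DecidableEquality V) {c : ℕ} {G : Graph V} (forest : IsDisjointUnionOfTrees c G)
    (vertex? : Decidable (Graph.Vertex G)) (adj? : Decidable₂ (Graph.Adj G))
    (vs : List V) (!vs : Unique vs) (∈vs : ∀ v → v ∈ vs)
    where
    open Graph G
    open IsDisjointUnionOfTrees forest
    open Forest forest using (acyclic; part-Star; connected-part)

    Listed : List (V × V) → Rel V 0ℓ
    Listed es u v = (u , v) ∈ es ⊎ (v , u) ∈ es

    AdjIn : List (V × V) → Rel V 0ℓ
    AdjIn es u v = Adj u v × Listed es u v

    adjIn-sym : ∀ {es} → Symmetric (AdjIn es)
    adjIn-sym (e , inj₁ m) = adj-sym e , inj₂ m
    adjIn-sym (e , inj₂ m) = adj-sym e , inj₁ m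

    root? : (rep : V → V) → Decidable (λ v → Vertex v × rep v ≡ v)
    root? rep v = vertex? v ×-dec (rep v ≟ v)

    edge : V × V → ℕ
    edge (u , v) = 𝟙 (adj? u v)

    -- The invariant is `count`. As `rep` is defined on all of `V`, only fixed points that are
    -- vertices count as roots; listed pairs that are not edges contribute nothing.
    record Components (es : List (V × V)) : Set where
      field
        rep    : V → V
        idem   : ∀ v → rep (rep v) ≡ rep v
        path   : ∀ v → Star (AdjIn es) v (rep v)
        merged : ∀ {u v} → AdjIn es u v → rep u ≡ rep v
        count  : ∑ vs (𝟙 ∘ vertex?) ≡ ∑ vs (𝟙 ∘ root? rep) + ∑ es edge

      Star⇒rep≡ : ∀ {u v} → Star (AdjIn es) u v → rep u ≡ rep v
      Star⇒rep≡ ε       = refl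
      Star⇒rep≡ (e ◅ p) = trans (merged e) (Star⇒rep≡ p)

    discrete : Components []
    discrete = record
      { rep    = id
      ; idem   = λ _ → refl
      ; path   = λ _ → ε
      ; merged = λ { (_ , inj₁ ()) ; (_ , inj₂ ()) }
      ; count  = trans (∑-cong vs (λ v → 𝟙-cong (vertex? v) (root? id v) (_, refl) proj₁))
                       (sym (+-identityʳ _))
      }
      where
      𝟙-cong : ∀ {P Q : Set} (P? : Dec P) (Q? : Dec Q) → (P → Q) → (Q → P) → 𝟙 P? ≡ 𝟙 Q?
      𝟙-cong (yes p) Q? f g = sym (𝟙-yes Q? (f p))
      𝟙-cong (no ¬p) Q? f g = sym (𝟙-no Q? (¬p ∘ g))

    weaken : ∀ {es p} → AdjIn es ⇒ AdjIn (p ∷ es)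
    weaken (e , inj₁ m) = e , inj₁ (there m)
    weaken (e , inj₂ m) = e , inj₂ (there m)

    add-non-edge : ∀ {es a b} → ¬ Adj a b → Components es → Components ((a , b) ∷ es)
    add-non-edge {es} {a} {b} ¬ab C = record
      { rep    = rep
      ; idem   = idem
      ; path   = λ v → Star.map weaken (path v)
      ; merged = λ { (e , inj₁ (here refl)) → contradiction e ¬ab
                   ; (e , inj₂ (here refl)) → contradiction (adj-sym e) ¬ab
                   ; (e , inj₁ (there m)) → merged (e , inj₁ m)
                   ; (e , inj₂ (there m)) → merged (e , inj₂ m) }
      ; count  = subst (λ k → ∑ vs (𝟙 ∘ vertex?) ≡ ∑ vs (𝟙 ∘ root? rep) + (k + ∑ es edge))
                   (sym (𝟙-no (adj? a b) ¬ab)) count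
      }
      where open Components C

    -- The ends of a new edge lie in different components, since a path between them would close to
    -- a cycle. Redirecting the root of `a` to that of `b` loses exactly one root.
    add-edge : ∀ {es a b} → Adj a b → ¬ Listed es a b → Components es → Components ((a , b) ∷ es)
    add-edge {es} {a} {b} ab new C = record
      { rep    = rep′
      ; idem   = idem′
      ; path   = path′
      ; merged = λ { (e , inj₁ (here refl)) → rep′a≡rep′b
                   ; (e , inj₂ (here refl)) → sym rep′a≡rep′b
                   ; (e , inj₁ (there m)) → cong retarget (merged (e , inj₁ m))
                   ; (e , inj₂ (there m)) → cong retarget (merged (e , inj₂ m)) }
      ; count  = count′
      }
      where
      open Components C

      retarget : V → V
      retarget r with r ≟ rep a
      ... | yes _ = rep b
      ... | no  _ = r

      rep′ : V → V
      rep′ = retarget ∘ rep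

      rep-a≢rep-b : rep a ≢ rep b
      rep-a≢rep-b eq = no-detour _≟_ {G} acyclic {H = AdjIn es} proj₁ ab (new ∘ proj₂)
        (path a ◅◅ subst (λ r → Star (AdjIn es) r b) (sym eq) (Star.reverse adjIn-sym (path b)))

      retarget-≡ : ∀ {r} → r ≡ rep a → retarget r ≡ rep b
      retarget-≡ {r} eq with r ≟ rep a
      ... | yes _  = refl
      ... | no neq = contradiction eq neq

      retarget-≢ : ∀ {r} → r ≢ rep a → retarget r ≡ r
      retarget-≢ {r} neq with r ≟ rep a
      ... | yes eq = contradiction eq neq
      ... | no _   = refl

      rep′a≡rep′b : rep′ a ≡ rep′ b
      rep′a≡rep′b = trans (retarget-≡ refl) (sym (retarget-≢ (rep-a≢rep-b ∘ sym)))

      idem′ : ∀ v → rep′ (rep′ v) ≡ rep′ v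
      idem′ v with rep v ≟ rep a
      ... | yes _  = trans (cong retarget (idem b)) (retarget-≢ (rep-a≢rep-b ∘ sym))
      ... | no neq = trans (cong retarget (idem v)) (retarget-≢ neq)

      path′ : ∀ v → Star (AdjIn ((a , b) ∷ es)) v (rep′ v)
      path′ v with rep v ≟ rep a
      ... | no _   = Star.map weaken (path v)
      -- From `v` to the root shared with `a`, back to `a`, over the new edge and on to the root of
      -- `b`.
      ... | yes eq =
        Star.map weaken (path v ◅◅
          subst (λ r → Star (AdjIn es) r a) (sym eq) (Star.reverse adjIn-sym (path a)))
        ◅◅ (ab , inj₁ (here refl)) ◅ Star.map weaken (path b)

      root-split : ∀ v → (Vertex v × rep v ≡ v) ⇔ ((Vertex v × rep′ v ≡ v) ⊎ v ≡ rep a)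
      root-split v = mk⇔ to from
        where
        to : Vertex v × rep v ≡ v → (Vertex v × rep′ v ≡ v) ⊎ v ≡ rep a
        to (vtx , eq) with v ≟ rep a
        ... | yes v≡ = inj₂ v≡
        ... | no  v≢ = inj₁ (vtx , trans (retarget-≢ (v≢ ∘ trans (sym eq))) eq)

        from : (Vertex v × rep′ v ≡ v) ⊎ v ≡ rep a → Vertex v × rep v ≡ v
        from (inj₂ refl) = Vertex-Star G (Star.map proj₁ (path a)) (proj₁ (adj-vertex ab)) , idem a
        from (inj₁ (vtx , eq)) with rep v ≟ rep a
        ... | no  _  = vtx , eq
        -- Here `eq` reads `rep b ≡ v`, so `v` is the root of `b` and yet has root `rep a`.
        ... | yes va = contradiction (trans (sym va) (trans (cong rep (sym eq)) (idem b))) rep-a≢rep-b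

      root-disjoint : ∀ v → ¬ ((Vertex v × rep′ v ≡ v) × v ≡ rep a)
      root-disjoint v ((_ , eq) , refl) =
        rep-a≢rep-b (trans (sym eq) (retarget-≡ (idem a)))

      count′ : ∑ vs (𝟙 ∘ vertex?) ≡ ∑ vs (𝟙 ∘ root? rep′) + (𝟙 (adj? a b) + ∑ es edge)
      count′ = begin
        ∑ vs (𝟙 ∘ vertex?)
          ≡⟨ count ⟩
        ∑ vs (𝟙 ∘ root? rep) + ∑ es edge
          ≡⟨ cong (_+ ∑ es edge) (∑-cong vs (λ v →
               𝟙-⊎ (root? rep v) (root? rep′ v) (v ≟ rep a) (root-split v) (root-disjoint v))) ⟩
        ∑ vs (λ v → 𝟙 (root? rep′ v) + 𝟙 (v ≟ rep a)) + ∑ es edge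
          ≡⟨ cong (_+ ∑ es edge) (∑-+ vs _ _) ⟩
        ∑ vs (𝟙 ∘ root? rep′) + ∑ vs (λ v → 𝟙 (v ≟ rep a)) + ∑ es edge
          ≡⟨ +-assoc (∑ vs (𝟙 ∘ root? rep′)) _ _ ⟩
        ∑ vs (𝟙 ∘ root? rep′) + (∑ vs (λ v → 𝟙 (v ≟ rep a)) + ∑ es edge)
          ≡⟨ cong (λ k → ∑ vs (𝟙 ∘ root? rep′) + (k + ∑ es edge))
               (trans (∑-𝟙-unique (_≟ rep a) !vs (∈vs (rep a)) refl (λ _ → id)) (sym (𝟙-yes (adj? a b) ab))) ⟩
        ∑ vs (𝟙 ∘ root? rep′) + (𝟙 (adj? a b) + ∑ es edge) ∎
        where open ≡-Reasoning

    components : ∀ {es} → AllPairs (λ p q → p ≢ q × p ≢ swap q) es → Components es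
    components [] = discrete
    components {(a , b) ∷ es} (new ∷ rest) with adj? a b
    ... | no ¬ab = add-non-edge ¬ab (components rest)
    ... | yes ab = add-edge ab
      [ (λ m → proj₁ (All.lookup new m) refl) , (λ m → proj₂ (All.lookup new m) refl) ]′
      (components rest)

    -- Once every edge is listed, the components are the trees, and the representatives of one
    -- chosen vertex per tree are all the roots.
    vertices≡edges+trees : ∀ {es} → AllPairs (λ p q → p ≢ q × p ≢ swap q) es →
      (∀ {u v} → Adj u v → Listed es u v) → ∑ vs (𝟙 ∘ vertex?) ≡ ∑ es edge + c
    vertices≡edges+trees {es} !es complete =
      trans count (trans (cong (_+ ∑ es edge) #roots≡c) (+-comm c _))
      where
      open Components (components !es)

      vertexOf : Fin c → V
      vertexOf i = proj₁ (IsTree.nonempty (trees i))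

      root : Fin c → V
      root i = rep (vertexOf i)

      root-part : ∀ i → part i (root i)
      root-part i = part-Star (Star.map proj₁ (path _)) (proj₂ (proj₂ (IsTree.nonempty (trees i))))

      root-vertex : ∀ i → Vertex (root i)
      root-vertex i = Vertex-Star G (Star.map proj₁ (path _)) (proj₁ (proj₂ (IsTree.nonempty (trees i))))

      root-injective : ∀ {i j} → root i ≡ root j → i ≡ j
      root-injective {i} {j} eq =
        disjoint (root-vertex j) (subst (part i) eq (root-part i)) (root-part j)

      root-covers : ∀ {v} → Vertex v → rep v ≡ v → v ∈ map root (allFin c)
      root-covers {v} vtx eq with i , pv ← covers vtx =
        subst (_∈ map root (allFin c)) root≡v (∈-map⁺ root (∈-allFin i))
        where
        root≡v : root i ≡ v
        root≡v = trans (sym (idem (vertexOf i)))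
          (trans (Star⇒rep≡ (Star.map (λ e → e , complete e)
                   (connected-part (root-vertex i) vtx (root-part i) pv))) eq)

      #roots≡c : ∑ vs (𝟙 ∘ root? rep) ≡ c
      #roots≡c = HasCard-unique (∑-HasCard (root? rep) !vs)
        ( map root (allFin c)
        , Unique.map⁺ root-injective (Unique.allFin⁺ c)
        , trans (length-map root (allFin c)) (length-tabulate id)
        , λ v → mk⇔
            (λ v∈ → ∈vs v , let i , _ , eq = ∈-map⁻ root v∈ in
              subst (λ u → Vertex u × rep u ≡ u) (sym eq) (root-vertex i , idem (vertexOf i)))
            (λ (_ , vtx , eq) → root-covers vtx eq))

-- Auxiliary facts on lists

module _ {X : Set} where

  length-∷ʳ : ∀ (x : X) xs → length (xs ∷ʳ x) ≡ suc (length xs)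
  length-∷ʳ x xs = trans (length-++ xs) (+-comm (length xs) 1)

  AllPairs-∈ : ∀ {R : Rel X 0ℓ} {xs} → (∀ {x y} → x ∈ xs → y ∈ xs → R x y) → AllPairs R xs
  AllPairs-∈ {xs = []}     f = []
  AllPairs-∈ {xs = x ∷ xs} f = All.tabulate (f (here refl) ∘ there) ∷ AllPairs-∈ (λ p q → f (there p) (there q))

-- Tree sets

module TreeSetProperties
  {A : Set} (_≟_ : DecidableEquality A)
  (as : List A) (!as : Unique as) (∈as : ∀ a → a ∈ as)
  {S : Pred (List A) 0ℓ} {c : ℕ} (T : TreeSet S c) (ε∈S : S [])
  where
  open TreeSet T
  open Factorial factorial

  prefix-closed : ∀ u v → S (u ++ v) → S u
  prefix-closed = factors []

  suffix-closed : ∀ u v → S (u ++ v) → S v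
  suffix-closed u v s = factors u v [] (subst S (cong (u ++_) (sym (++-identityʳ v))) s)

  χ : List A → ℕ
  χ []      = c
  χ (_ ∷ _) = 1

  forest : ∀ w → S w → IsDisjointUnionOfTrees (χ w) (extensionGraph S factorial w)
  forest []      _ = empty-trees
  forest (_ ∷ _) s = tree⇒disjointUnion (nonempty-tree s (λ ()))

  _≟⊎_ : DecidableEquality (A ⊎ A)
  _≟⊎_ = ⊎-≡-dec _≟_ _≟_

  -- If aw and wb are in S, a simple path from a to b in the forest E(w) is either the edge (a, b)
  -- or excludes it.
  member?-bounded : ∀ k w → length w ≤ k → Dec (S w)
  member?-bounded k       []      _        = yes ε∈S
  member?-bounded (suc k) (a ∷ w) (s≤s le) with initLast w
  ... | []      = yes (letters a)
  ... | m ∷ʳ′ b with member?-bounded k (a ∷ m) (subst (_≤ k) (length-∷ʳ b m) le)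
                   | member?-bounded k (m ∷ʳ b) le
  ...   | yes am | yes mb =
    Forest.adj? (forest m (suffix-closed [ a ] m am)) _≟⊎_ {inj₁ a} {inj₂ b} am mb
  ...   | no ¬am | _      = no (¬am ∘ prefix-closed (a ∷ m) [ b ])
  ...   | yes _  | no ¬mb = no (¬mb ∘ suffix-closed [ a ] (m ∷ʳ b))

  S? : Decidable S
  S? w = member?-bounded (length w) w ≤-refl

  s : List A → ℕ
  s w = 𝟙 (S? w)

  r : List A → ℕ
  r w = ∑ as (λ b → s (w ∷ʳ b))

  -- The subtraction never truncates on words of `S`: `neutral` shows that `r w` is at least `χ w`.
  ρ : List A → ℕ
  ρ w = r w ∸ χ w

  -- All pairs of letters are offered as edges of the extension graph of `w`; the actual edges at
  -- the left letter `a` number `r (a ∷ w)`.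
  vertices≡edges+χ : ∀ w → S w →
    ∑ as (λ a → s (a ∷ w)) + r w ≡ ∑ as (λ a → r (a ∷ w)) + χ w
  vertices≡edges+χ w w∈S = begin
    ∑ as (λ a → s (a ∷ w)) + r w
      ≡⟨ cong₂ _+_ (∑-map inj₁ as _) (∑-map inj₂ as _) ⟨
    ∑ (map inj₁ as) (𝟙 ∘ vertex?) + ∑ (map inj₂ as) (𝟙 ∘ vertex?)
      ≡⟨ ∑-++ (map inj₁ as) (map inj₂ as) _ ⟨
    ∑ vs (𝟙 ∘ vertex?)
      ≡⟨ vertices≡edges+trees !es complete ⟩
    ∑ es edge + χ w
      ≡⟨ cong (_+ χ w) (∑-cartesianProductWith _ as as edge) ⟩
    ∑ as (λ a → r (a ∷ w)) + χ w ∎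
    where
    open ≡-Reasoning

    vs : List (A ⊎ A)
    vs = map inj₁ as ++ map inj₂ as

    !vs : Unique vs
    !vs = Unique.++⁺ (Unique.map⁺ inj₁-injective !as) (Unique.map⁺ inj₂-injective !as)
      λ (p , q) → let _ , _ , e = ∈-map⁻ inj₁ p ; _ , _ , e′ = ∈-map⁻ inj₂ q in inj₁≢inj₂ (trans (sym e) e′)
      where
      inj₁≢inj₂ : ∀ {a b : A} → inj₁ a ≢ inj₂ b
      inj₁≢inj₂ ()

    ∈vs : ∀ v → v ∈ vs
    ∈vs (inj₁ a) = ∈-++⁺ˡ (∈-map⁺ inj₁ (∈as a))
    ∈vs (inj₂ b) = ∈-++⁺ʳ (map inj₁ as) (∈-map⁺ inj₂ (∈as b))

    vertex? : Decidable (ExtVertex S w)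
    vertex? (inj₁ a) = S? (a ∷ w)
    vertex? (inj₂ b) = S? (w ∷ʳ b)

    adj? : Decidable₂ (ExtAdj S w)
    adj? (inj₁ a) (inj₂ b) = S? (a ∷ w ∷ʳ b)
    adj? (inj₂ b) (inj₁ a) = S? (a ∷ w ∷ʳ b)
    adj? (inj₁ _) (inj₁ _) = no λ ()
    adj? (inj₂ _) (inj₂ _) = no λ ()

    open SpanningForest _≟⊎_ (forest w w∈S) vertex? adj? vs !vs ∈vs

    arc : A → A → (A ⊎ A) × (A ⊎ A)
    arc a b = inj₁ a , inj₂ b

    es : List ((A ⊎ A) × (A ⊎ A))
    es = cartesianProductWith arc as as

    oriented : ∀ {p q} → p ∈ es → q ∈ es → p ≢ swap q
    oriented p∈ q∈ p≡ with ∈-cartesianProductWith⁻ arc as as p∈ | ∈-cartesianProductWith⁻ arc as as q∈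
    oriented p∈ q∈ () | _ , _ , _ , _ , refl | _ , _ , _ , _ , refl

    !es : AllPairs (λ p q → p ≢ q × p ≢ swap q) es
    !es = AllPairs.zip
      ( Unique.cartesianProductWith⁺ arc (λ { refl → refl , refl }) !as !as
      , AllPairs-∈ oriented)

    complete : ∀ {u v} → ExtAdj S w u v → Listed es u v
    complete {inj₁ a} {inj₂ b} _ = inj₁ (∈-cartesianProductWith⁺ arc (∈as a) (∈as b))
    complete {inj₂ b} {inj₁ a} _ = inj₂ (∈-cartesianProductWith⁺ arc (∈as a) (∈as b))

  r≡1+ρ : ∀ {w} → w ≢ [] → S w → r w ≡ suc (ρ w)
  r≡1+ρ {[]}    w≢[] _   = contradiction refl w≢[]
  r≡1+ρ {w@(_ ∷ _)} _ w∈S with a , b , awb∈S ← extend w∈S =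
    sym (m+[n∸m]≡n (subst (_≤ r w) (𝟙-yes (S? (w ∷ʳ b)) (suffix-closed [ a ] (w ∷ʳ b) awb∈S))
      (∈⇒≤∑ (λ b → s (w ∷ʳ b)) (∈as b))))

  -- Both sides vanish outside `S`, which allows summing the identity over all letters.
  r-split : ∀ {w} → w ≢ [] → r w ≡ s w + s w * ρ w
  r-split {w} w≢[] with S? w
  ... | yes w∈S = trans (r≡1+ρ w≢[] w∈S) (cong suc (sym (+-identityʳ (ρ w))))
  ... | no  w∉S = ∑-zero as (λ {b} _ → 𝟙-no (S? (w ∷ʳ b)) (w∉S ∘ prefix-closed w [ b ]))

  -- Expanding each `r (a ∷ w)` by `r-split` makes the number of left extensions appear on both
  -- sides of the vertex count, where it cancels.
  neutral : ∀ w → S w → r w ≡ ∑ as (λ a → s (a ∷ w) * ρ (a ∷ w)) + χ w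
  neutral w w∈S = +-cancelˡ-≡ (∑ as (λ a → s (a ∷ w))) _ _ (begin
    ∑ as (λ a → s (a ∷ w)) + r w
      ≡⟨ vertices≡edges+χ w w∈S ⟩
    ∑ as (λ a → r (a ∷ w)) + χ w
      ≡⟨ cong (_+ χ w) (trans (∑-cong as (λ a → r-split {a ∷ w} (λ ()))) (∑-+ as _ _)) ⟩
    ∑ as (λ a → s (a ∷ w)) + ∑ as (λ a → s (a ∷ w) * ρ (a ∷ w)) + χ w
      ≡⟨ +-assoc (∑ as (λ a → s (a ∷ w))) _ _ ⟩
    ∑ as (λ a → s (a ∷ w)) + (∑ as (λ a → s (a ∷ w) * ρ (a ∷ w)) + χ w) ∎)
    where open ≡-Reasoning

  ρ-sum : ∀ w → S w → ρ w ≡ ∑ as (λ a → s (a ∷ w) * ρ (a ∷ w))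
  ρ-sum w w∈S = trans (cong (_∸ χ w) (neutral w w∈S)) (m+n∸n≡m _ (χ w))

  -- The case of the empty word: all letters are in `S`, so `r []` is the size of the alphabet.
  length-as : length as ≡ ρ [] + c
  length-as = begin
    length as ≡⟨ ∑-one as ⟩
    r []      ≡⟨ neutral [] ε∈S ⟩
    ∑ as (λ a → s [ a ] * ρ [ a ]) + c ≡⟨ cong (_+ c) (ρ-sum [] ε∈S) ⟨
    ρ [] + c ∎
    where
    open ≡-Reasoning
    ∑-one : ∀ as → length as ≡ ∑ as (λ a → s [ a ])
    ∑-one []       = refl
    ∑-one (a ∷ as) = cong₂ _+_ (sym (𝟙-yes (S? [ a ]) (letters a))) (∑-one as)

-- Enumeration of words

module Words {A : Set} (as : List A) (!as : Unique as) (∈as : ∀ a → a ∈ as) where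

  words : ℕ → List (List A)
  words zero    = [ [] ]
  words (suc k) = cartesianProductWith _∷_ as (words k)

  !words : ∀ k → Unique (words k)
  !words zero    = [] ∷ []
  !words (suc k) = Unique.cartesianProductWith⁺ _∷_ ∷-injective !as (!words k)

  ∈words : ∀ w → w ∈ words (length w)
  ∈words []      = here refl
  ∈words (a ∷ w) = ∈-cartesianProductWith⁺ _∷_ (∈as a) (∈words w)

  ∈words⇒length : ∀ k {w} → w ∈ words k → length w ≡ k
  ∈words⇒length zero    (here refl) = refl
  ∈words⇒length (suc k) w∈
    with _ , _ , _ , v∈ , refl ← ∈-cartesianProductWith⁻ _∷_ as (words k) w∈
    = cong suc (∈words⇒length k v∈)

  ∑-words-∷ : ∀ k f → ∑ (words (suc k)) f ≡ ∑ (words k) (λ w → ∑ as (λ a → f (a ∷ w)))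
  ∑-words-∷ k f = trans (∑-cartesianProductWith _∷_ as (words k) f) (∑-swap as (words k) _)

  -- `words` grows on the left, so the first letter is split off and the induction runs on the
  -- remaining word.
  ∑-words-∷ʳ : ∀ k f → ∑ (words (suc k)) f ≡ ∑ (words k) (λ w → ∑ as (λ b → f (w ∷ʳ b)))
  ∑-words-∷ʳ zero    f = ∑-words-∷ zero f
  ∑-words-∷ʳ (suc k) f = begin
    ∑ (words (suc (suc k))) f
      ≡⟨ ∑-cartesianProductWith _∷_ as (words (suc k)) f ⟩
    ∑ as (λ a → ∑ (words (suc k)) (λ w → f (a ∷ w)))
      ≡⟨ ∑-cong as (λ a → ∑-words-∷ʳ k (λ w → f (a ∷ w))) ⟩
    ∑ as (λ a → ∑ (words k) (λ w → ∑ as (λ b → f (a ∷ w ∷ʳ b))))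
      ≡⟨ ∑-cartesianProductWith _∷_ as (words k) _ ⟨
    ∑ (words (suc k)) (λ w → ∑ as (λ b → f (w ∷ʳ b))) ∎
    where open ≡-Reasoning

  upto : ℕ → List (List A)
  upto zero    = words zero
  upto (suc k) = upto k ++ words (suc k)

  ∈upto⇒length : ∀ k {w} → w ∈ upto k → length w ≤ k
  ∈upto⇒length zero    w∈ = ≤-reflexive (∈words⇒length zero w∈)
  ∈upto⇒length (suc k) w∈ with ∈-++⁻ (upto k) w∈
  ... | inj₁ p = m≤n⇒m≤1+n (∈upto⇒length k p)
  ... | inj₂ p = ≤-reflexive (∈words⇒length (suc k) p)

  length⇒∈upto : ∀ k {w} → length w ≤ k → w ∈ upto k
  length⇒∈upto zero    {[]} _  = here refl
  length⇒∈upto (suc k) {w}  le with m≤n⇒m<n∨m≡n le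
  ... | inj₁ (s≤s lt) = ∈-++⁺ˡ (length⇒∈upto k lt)
  ... | inj₂ eq       = ∈-++⁺ʳ (upto k) (subst (λ m → w ∈ words m) eq (∈words w))

  !upto : ∀ k → Unique (upto k)
  !upto zero    = !words zero
  !upto (suc k) = Unique.++⁺ (!upto k) (!words (suc k)) λ (p , q) →
    1+n≰n (subst (_≤ k) (∈words⇒length (suc k) q) (∈upto⇒length k p))

-- Return words

module Returns
  {A : Set} (_≟_ : DecidableEquality A)
  (as : List A) (!as : Unique as) (∈as : ∀ a → a ∈ as)
  {S : Pred (List A) 0ℓ} {c : ℕ} (T : TreeSet S c) (rec : Recurrent S)
  (x₀ : A) (x′ : List A) (x∈S : S (x₀ ∷ x′))
  where
  open TreeSet T using (factorial)
  open Factorial factorial using (factors)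
  open Recurrent rec using (recur)
  open TreeSetProperties _≟_ as !as ∈as T (factors [] [] (x₀ ∷ x′) x∈S)
  open Words as !as ∈as

  x : List A
  x = x₀ ∷ x′

  -- Occurrences of x, avoiding words and rooted words

  IsPrefix Occurs : List A → Set
  IsPrefix = Prefix _≡_ x
  Occurs   = Infix _≡_ x

  occurs? : Decidable Occurs
  occurs? = infix? _≟_ x

  IsPrefix⇒++ : ∀ {w} → IsPrefix w → ∃ λ v → w ≡ x ++ v
  IsPrefix⇒++ p with Prefix.toView p
  ... | eq Prefix.++ v = v , cong (_++ v) (sym (Pointwise-≡⇒≡ eq))

  ++⇒IsPrefix : ∀ v → IsPrefix (x ++ v)
  ++⇒IsPrefix v = Prefix.fromView (≡⇒Pointwise-≡ refl Prefix.++ v)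

  Occurs⇒++ : ∀ {w} → Occurs w → ∃₂ λ p q → w ≡ p ++ x ++ q
  Occurs⇒++ o with Infix.toView o
  ... | Infix.MkView p eq q = p , q , cong (λ v → p ++ v ++ q) (sym (Pointwise-≡⇒≡ eq))

  ++⇒Occurs : ∀ p q → Occurs (p ++ x ++ q)
  ++⇒Occurs p q = p ++ⁱ here (++⇒IsPrefix q)

  occurs-suffix : ∀ p → Occurs (p ++ x)
  occurs-suffix p = subst (λ v → Occurs (p ++ v)) (++-identityʳ x) (++⇒Occurs p [])

  Prefix-++⁻ : ∀ {xs : List A} u {v} → length xs ≤ length u → Prefix _≡_ xs (u ++ v) → Prefix _≡_ xs u
  Prefix-++⁻ {[]}    u       _        _        = []
  Prefix-++⁻ {_ ∷ _} (_ ∷ u) (s≤s le) (e ∷ es) = e ∷ Prefix-++⁻ u le es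

  -- The occurrences of `x` in `drop 1 w` are those in `w` that start after its first letter; they
  -- may overlap the prefix `x`.
  Avoiding Rooted : List A → Set
  Avoiding w = S w × ¬ Occurs w
  Rooted w   = S w × IsPrefix w × ¬ Occurs (drop 1 w)

  avoiding? : Decidable Avoiding
  avoiding? w = S? w ×-dec ¬? (occurs? w)

  rooted? : Decidable Rooted
  rooted? w = S? w ×-dec (prefix? _≟_ x w ×-dec ¬? (occurs? (drop 1 w)))

  rooted-length : ∀ {w} → Rooted w → length x ≤ length w
  rooted-length (_ , p , _) = Prefix.length-mono p

  rooted-prefix : ∀ u v → length x ≤ length u → Rooted (u ++ v) → Rooted u
  rooted-prefix u@(a ∷ t) v le (uv∈S , p , avoid) =
    prefix-closed u v uv∈S , Prefix-++⁻ u le p , λ o → avoid (o ⁱ++ v)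

  -- Rootedness passes to prefixes at least as long as `x`, so a length without rooted words rules
  -- out all greater lengths.
  rooted-at-level : ∀ {u} k → length x ≤ k → k ≤ length u → Rooted u → ∃ λ v → length v ≡ k × Rooted v
  rooted-at-level {u} k x≤k k≤u ru =
    take k u , len , rooted-prefix (take k u) (drop k u) (subst (length x ≤_) (sym len) x≤k)
      (subst Rooted (sym (take++drop≡id k u)) ru)
    where
    len : length (take k u) ≡ k
    len = trans (length-take k u) (m≤n⇒m⊓n≡m k≤u)

  -- An occurrence created by prepending a letter must be a prefix.
  avoiding-split : ∀ w a → 𝟙 (avoiding? w) * s (a ∷ w) ≡ 𝟙 (avoiding? (a ∷ w)) + 𝟙 (rooted? (a ∷ w))
  avoiding-split w a = trans
    (sym (𝟙-× (avoiding? w ×-dec S? (a ∷ w)) (avoiding? w) (S? (a ∷ w)) (mk⇔ id id)))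
    (𝟙-⊎ (avoiding? w ×-dec S? (a ∷ w)) (avoiding? (a ∷ w)) (rooted? (a ∷ w)) (mk⇔ to from)
      λ ((_ , ¬o) , _ , p , _) → ¬o (here p))
    where
    to : Avoiding w × S (a ∷ w) → Avoiding (a ∷ w) ⊎ Rooted (a ∷ w)
    to ((_ , ¬o) , aw∈S) with prefix? _≟_ x (a ∷ w)
    ... | yes p = inj₂ (aw∈S , p , ¬o)
    ... | no ¬p = inj₁ (aw∈S , [ ¬p , ¬o ]′ ∘ Infix.∷⁻)

    from : Avoiding (a ∷ w) ⊎ Rooted (a ∷ w) → Avoiding w × S (a ∷ w)
    from (inj₁ (aw∈S , ¬o))     = (suffix-closed [ a ] w aw∈S , ¬o ∘ there) , aw∈S
    from (inj₂ (aw∈S , _ , ¬o)) = (suffix-closed [ a ] w aw∈S , ¬o) , aw∈S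

  -- Complete returns as one-letter extensions of rooted words

  last-letter : ∀ {u b} p q {d} → u ∷ʳ b ≡ p ++ x ++ (q ∷ʳ d) → Occurs u
  last-letter {u} p q {d} eq = subst Occurs (sym (∷ʳ-injectiveˡ u (p ++ x ++ q) (begin
    u ∷ʳ _               ≡⟨ eq ⟩
    p ++ x ++ (q ∷ʳ d)   ≡⟨ cong (p ++_) (++-assoc x q [ d ]) ⟨
    p ++ (x ++ q) ∷ʳ d   ≡⟨ ++-assoc p (x ++ q) [ d ] ⟨
    (p ++ x ++ q) ∷ʳ d   ∎))) (++⇒Occurs p q)
    where open ≡-Reasoning

  -- Removing the last letter of a complete return destroys the final occurrence of `x` and keeps
  -- the initial one. Conversely, a second occurrence created by the last letter is a suffix, as any
  -- other would already lie in `u`.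
  completeReturn⇔ : ∀ u b →
    CompleteReturn S x (u ∷ʳ b) ⇔ (Rooted u × S (u ∷ʳ b) × Occurs (drop 1 (u ∷ʳ b)))
  completeReturn⇔ u b = mk⇔ to from
    where
    to : CompleteReturn S x (u ∷ʳ b) → Rooted u × S (u ∷ʳ b) × Occurs (drop 1 (u ∷ʳ b))
    to cr with v , v≢[] , eq ← CompleteReturn.proper-prefix cr with initLast v
    ... | []      = contradiction refl v≢[]
    ... | w ∷ʳ′ d
      with refl , refl ← ∷ʳ-injective u (x ++ w) (trans eq (sym (++-assoc x w [ d ])))
      = (prefix-closed u [ d ] member , ++⇒IsPrefix w , avoid) , member , again
      where
      open CompleteReturn cr

      avoid : ¬ Occurs (x′ ++ w)
      -- Such an occurrence is internal: it has `x₀` before it and `d` after it.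
      avoid o with p , q , eq′ ← Occurs⇒++ o = not-internal
        ( x₀ ∷ p , q ∷ʳ d , (λ ()) , (λ e → contradiction (++-conicalʳ q [ d ] e) (λ ()))
        , cong (x₀ ∷_) (trans (cong (_∷ʳ d) eq′) (trans (++-assoc p (x ++ q) [ d ])
            (cong (p ++_) (++-assoc x q [ d ])))))

      again : Occurs ((x′ ++ w) ∷ʳ d)
      again with proper-suffix
      ... | []    , p≢[] , _   = contradiction refl p≢[]
      ... | _ ∷ p , _    , eq′ = subst Occurs (sym (∷-injectiveʳ eq′)) (occurs-suffix p)

    from : Rooted u × S (u ∷ʳ b) × Occurs (drop 1 (u ∷ʳ b)) → CompleteReturn S x (u ∷ʳ b)
    from ((_ , pre , avoid) , ub∈S , o) with v , refl ← IsPrefix⇒++ pre = record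
      { member        = ub∈S
      ; proper-prefix = v ∷ʳ b , (λ e → contradiction (++-conicalʳ v [ b ] e) (λ ())) , ++-assoc x v [ b ]
      ; proper-suffix = suffix
      ; not-internal  = internal
      }
      where
      suffix : ∃ λ p → p ≢ [] × u ∷ʳ b ≡ p ++ x
      suffix with p , q , eq ← Occurs⇒++ o with initLast q
      ... | []      = x₀ ∷ p , (λ ()) , cong (x₀ ∷_) (trans eq (cong (p ++_) (++-identityʳ x)))
      ... | q ∷ʳ′ d = contradiction (last-letter p q eq) avoid

      internal : ¬ InternalFactor x (u ∷ʳ b)
      internal ([]    , _ , p≢[] , _) = p≢[] refl
      internal (_ ∷ p , q , _ , q≢[] , eq) with initLast q
      ... | []      = q≢[] refl
      ... | q ∷ʳ′ d = avoid (last-letter p q (∷-injectiveʳ eq))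

  completeReturn? : Decidable (CompleteReturn S x)
  completeReturn? w with initLast w
  ... | []      = no λ cr → case-[] (CompleteReturn.proper-prefix cr)
    where
    case-[] : ¬ (∃ λ v → v ≢ [] × [] ≡ x ++ v)
    case-[] (_ , _ , ())
  ... | u ∷ʳ′ b = map′ (Equivalence.from (completeReturn⇔ u b)) (Equivalence.to (completeReturn⇔ u b))
    (rooted? u ×-dec (S? (u ∷ʳ b) ×-dec occurs? (drop 1 (u ∷ʳ b))))

  rooted-∷ʳ : ∀ {u b} → Rooted u → S (u ∷ʳ b) → ¬ Occurs (drop 1 (u ∷ʳ b)) → Rooted (u ∷ʳ b)
  rooted-∷ʳ (_ , pre , _) ub∈S ¬o = ub∈S , pre ++ᵖ _ , ¬o

  -- A letter appended to a rooted word either keeps it rooted or creates a second occurrence. The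
  -- length bound keeps the prefix `x` within `u` when the letter is removed again.
  rooted-split : ∀ u b → length x ≤ length u →
    𝟙 (rooted? u) * s (u ∷ʳ b) ≡ 𝟙 (rooted? (u ∷ʳ b)) + 𝟙 (completeReturn? (u ∷ʳ b))
  rooted-split u b le = trans
    (sym (𝟙-× (rooted? u ×-dec S? (u ∷ʳ b)) (rooted? u) (S? (u ∷ʳ b)) (mk⇔ id id)))
    (𝟙-⊎ (rooted? u ×-dec S? (u ∷ʳ b)) (rooted? (u ∷ʳ b)) (completeReturn? (u ∷ʳ b)) (mk⇔ to from)
      λ ((_ , _ , ¬o) , cr) → ¬o (proj₂ (proj₂ (Equivalence.to (completeReturn⇔ u b) cr))))
    where
    to : Rooted u × S (u ∷ʳ b) → Rooted (u ∷ʳ b) ⊎ CompleteReturn S x (u ∷ʳ b)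
    to (ru , ub∈S) with occurs? (drop 1 (u ∷ʳ b))
    ... | yes o = inj₂ (Equivalence.from (completeReturn⇔ u b) (ru , ub∈S , o))
    ... | no ¬o = inj₁ (rooted-∷ʳ ru ub∈S ¬o)

    from : Rooted (u ∷ʳ b) ⊎ CompleteReturn S x (u ∷ʳ b) → Rooted u × S (u ∷ʳ b)
    from (inj₁ rub) = rooted-prefix u [ b ] le rub , proj₁ rub
    from (inj₂ cr) with ru , ub∈S , _ ← Equivalence.to (completeReturn⇔ u b) cr = ru , ub∈S

  -- Counts by word length and their recurrences

  avoidingρ rootedρ : List A → ℕ
  avoidingρ w = 𝟙 (avoiding? w) * ρ w
  rootedρ w   = 𝟙 (rooted? w) * ρ w

  E #rooted #returns Q : ℕ → ℕ
  E k        = ∑ (words k) avoidingρ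
  #rooted k  = ∑ (words k) (𝟙 ∘ rooted?)
  #returns k = ∑ (words k) (𝟙 ∘ completeReturn?)
  Q k        = E k + #rooted (suc k)

  E-step : ∀ k → E k ≡ E (suc k) + ∑ (words (suc k)) rootedρ
  E-step k = begin
    ∑ (words k) avoidingρ
      ≡⟨ ∑-cong (words k) pointwise ⟩
    ∑ (words k) (λ w → ∑ as (λ a → avoidingρ (a ∷ w) + rootedρ (a ∷ w)))
      ≡⟨ ∑-words-∷ k _ ⟨
    ∑ (words (suc k)) (λ w → avoidingρ w + rootedρ w)
      ≡⟨ ∑-+ (words (suc k)) _ _ ⟩
    E (suc k) + ∑ (words (suc k)) rootedρ ∎
    where
    open ≡-Reasoning

    distribute : ∀ w → avoidingρ w ≡ 𝟙 (avoiding? w) * ∑ as (λ a → s (a ∷ w) * ρ (a ∷ w))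
    distribute w with avoiding? w
    ... | yes (w∈S , _) = cong (1 *_) (ρ-sum w w∈S)
    ... | no _          = refl

    pointwise : ∀ w → avoidingρ w ≡ ∑ as (λ a → avoidingρ (a ∷ w) + rootedρ (a ∷ w))
    pointwise w = begin
      avoidingρ w
        ≡⟨ distribute w ⟩
      𝟙 (avoiding? w) * ∑ as (λ a → s (a ∷ w) * ρ (a ∷ w))
        ≡⟨ ∑-*ˡ as (𝟙 (avoiding? w)) _ ⟨
      ∑ as (λ a → 𝟙 (avoiding? w) * (s (a ∷ w) * ρ (a ∷ w)))
        ≡⟨ ∑-cong as (λ a → trans (sym (*-assoc (𝟙 (avoiding? w)) _ _))
             (trans (cong (_* ρ (a ∷ w)) (avoiding-split w a))
               (*-distribʳ-+ (ρ (a ∷ w)) (𝟙 (avoiding? (a ∷ w))) _))) ⟩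
      ∑ as (λ a → avoidingρ (a ∷ w) + rootedρ (a ∷ w)) ∎

  rooted-step : ∀ k → length x ≤ k →
    #rooted k + ∑ (words k) rootedρ ≡ #rooted (suc k) + #returns (suc k)
  rooted-step k le = begin
    #rooted k + ∑ (words k) rootedρ
      ≡⟨ ∑-+ (words k) _ _ ⟨
    ∑ (words k) (λ u → 𝟙 (rooted? u) + rootedρ u)
      ≡⟨ ∑-cong-∈ (words k) (λ {u} u∈ → trans (absorb u) (trans (sym (∑-*ˡ as (𝟙 (rooted? u)) _))
           (∑-cong as (λ b → rooted-split u b (subst (length x ≤_) (sym (∈words⇒length k u∈)) le))))) ⟩
    ∑ (words k) (λ u → ∑ as (λ b → 𝟙 (rooted? (u ∷ʳ b)) + 𝟙 (completeReturn? (u ∷ʳ b))))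
      ≡⟨ ∑-words-∷ʳ k _ ⟨
    ∑ (words (suc k)) (λ w → 𝟙 (rooted? w) + 𝟙 (completeReturn? w))
      ≡⟨ ∑-+ (words (suc k)) _ _ ⟩
    #rooted (suc k) + #returns (suc k) ∎
    where
    open ≡-Reasoning

    -- A rooted word is nonempty, so its extension graph is a single tree and `r` exceeds `ρ` by
    -- one.
    absorb : ∀ u → 𝟙 (rooted? u) + rootedρ u ≡ 𝟙 (rooted? u) * r u
    absorb u with rooted? u
    ... | no _  = refl
    ... | yes (u∈S , pre , _) = begin
      suc (1 * ρ u) ≡⟨ cong suc (*-identityˡ (ρ u)) ⟩
      suc (ρ u)     ≡⟨ r≡1+ρ (λ { refl → contradiction pre (λ ()) }) u∈S ⟨
      r u           ≡⟨ *-identityˡ (r u) ⟨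
      1 * r u       ∎

  -- What `E` loses from `k` to `suc k` is the sum of `ρ` over rooted words of length `suc k`, just
  -- what `rooted-step` takes in at that length; hence the shifted index in `Q`.
  Q-step : ∀ k → length x′ ≤ k → Q k ≡ Q (suc k) + #returns (suc (suc k))
  Q-step k le = begin
    E k + #rooted (suc k)
      ≡⟨ cong (_+ #rooted (suc k)) (E-step k) ⟩
    E (suc k) + ∑ (words (suc k)) rootedρ + #rooted (suc k)
      ≡⟨ +-assoc (E (suc k)) _ _ ⟩
    E (suc k) + (∑ (words (suc k)) rootedρ + #rooted (suc k))
      ≡⟨ cong (E (suc k) +_) (trans (+-comm _ (#rooted (suc k))) (rooted-step (suc k) (s≤s le))) ⟩
    E (suc k) + (#rooted (suc (suc k)) + #returns (suc (suc k)))
      ≡⟨ +-assoc (E (suc k)) _ _ ⟨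
    Q (suc k) + #returns (suc (suc k)) ∎
    where open ≡-Reasoning

  -- Words shorter than `x` are never rooted, so `E` keeps its value at length zero, where the empty
  -- word is the only term.
  E-initial : ∀ k → k ≤ length x′ → E k ≡ ρ []
  E-initial zero    _  = trans (+-identityʳ _)
    (trans (cong (_* ρ []) (𝟙-yes (avoiding? []) (prefix-closed [] x x∈S , λ { (here ()) }))) (*-identityˡ (ρ [])))
  E-initial (suc k) le = begin
    E (suc k)                                  ≡⟨ +-identityʳ (E (suc k)) ⟨
    E (suc k) + 0                              ≡⟨ cong (E (suc k) +_) (∑-zero (words (suc k)) no-root) ⟨
    E (suc k) + ∑ (words (suc k)) rootedρ      ≡⟨ E-step k ⟨
    E k                                        ≡⟨ E-initial k (≤-trans (n≤1+n k) le) ⟩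
    ρ []                                       ∎
    where
    open ≡-Reasoning
    no-root : ∀ {w} → w ∈ words (suc k) → rootedρ w ≡ 0
    no-root {w} w∈ = cong (_* ρ w) (𝟙-no (rooted? w) λ rw →
      1+n≰n (≤-trans (subst (length x ≤_) (∈words⇒length (suc k) w∈) (rooted-length rw)) le))

  #rooted-initial : #rooted (length x) ≡ 1
  #rooted-initial = ∑-𝟙-unique rooted? (!words (length x)) (∈words x)
    ( x∈S , subst IsPrefix (++-identityʳ x) (++⇒IsPrefix [])
    , λ o → 1+n≰n (Infix.length-mono o))
    λ w∈ (_ , pre , _) →
      sym (Pointwise-≡⇒≡ (Prefix.toPointwise (sym (∈words⇒length (length x) w∈)) pre))

  completeReturn-length : ∀ {w} → CompleteReturn S x w → length x < length w
  completeReturn-length cr with CompleteReturn.proper-prefix cr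
  ... | []    , v≢[] , _    = contradiction refl v≢[]
  ... | a ∷ v , _    , refl =
    subst (length x <_) (sym (length-++-sucʳ x a v)) (s≤s (length-++-≤ˡ x))

  -- Complete returns are longer than `x`, so none is counted at `d = 0`; each further level moves
  -- its complete returns from `Q` into the sum.
  balance : ∀ d → ∑ (upto (suc (d + length x′))) (𝟙 ∘ completeReturn?) + Q (d + length x′) ≡ suc (ρ [])
  balance zero = begin
    ∑ (upto (length x)) (𝟙 ∘ completeReturn?) + Q (length x′)
      ≡⟨ cong (_+ Q (length x′)) (∑-zero (upto (length x)) (λ {w} w∈ → 𝟙-no (completeReturn? w)
           (λ cr → <⇒≱ (completeReturn-length cr) (∈upto⇒length (length x) w∈)))) ⟩
    E (length x′) + #rooted (length x)
      ≡⟨ cong₂ _+_ (E-initial (length x′) ≤-refl) #rooted-initial ⟩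
    ρ [] + 1
      ≡⟨ +-comm (ρ []) 1 ⟩
    suc (ρ []) ∎
    where open ≡-Reasoning
  balance (suc d) = begin
    ∑ (upto (suc k)) f + Q k             ≡⟨ cong (_+ Q k) (∑-++ (upto k) (words (suc k)) f) ⟩
    ∑ (upto k) f + #returns (suc k) + Q k    ≡⟨ +-assoc (∑ (upto k) f) _ _ ⟩
    ∑ (upto k) f + (#returns (suc k) + Q k)  ≡⟨ cong (∑ (upto k) f +_) (trans (+-comm _ (Q k))
                                                   (sym (Q-step (d + length x′) (m≤n+m (length x′) d)))) ⟩
    ∑ (upto k) f + Q (d + length x′)         ≡⟨ balance d ⟩
    suc (ρ []) ∎
    where
    open ≡-Reasoning
    k = suc (d + length x′)
    f = 𝟙 ∘ completeReturn?

  -- Consequences of recurrence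

  last-occurrence : ∀ z w → ¬ Occurs w → Occurs (z ++ w) → S (z ++ w) →
    ∃ λ u → length w < length u × Rooted u
  last-occurrence []      w ¬o o _ = contradiction o ¬o
  last-occurrence (a ∷ z) w ¬o o azw∈S with occurs? (z ++ w)
  ... | yes o′ = last-occurrence z w ¬o o′ (suffix-closed [ a ] (z ++ w) azw∈S)
  -- The letter `a` is the last one whose removal destroys an occurrence, so that occurrence is a
  -- prefix and the rooted word properly extends `w`.
  ... | no ¬o′ = a ∷ z ++ w , s≤s (length-++-≤ʳ w {z}) , azw∈S ,
        [ id , (λ o′ → contradiction o′ ¬o′) ]′ (Infix.∷⁻ o) , ¬o′

  -- The letters of `v` are appended one by one; the word stays rooted until `x` first recurs, which
  -- completes a return.
  next-return : ∀ u v → Rooted u → S (u ++ v) → Occurs (drop 1 (u ++ v)) →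
    ∃ λ y → length u < length y × CompleteReturn S x y
  next-return u []      (_ , _ , ¬o) _ o = contradiction (subst (Occurs ∘ drop 1) (++-identityʳ u) o) ¬o
  next-return u (b ∷ v) ru ubv∈S o with occurs? (drop 1 (u ∷ʳ b))
  ... | yes o′ = u ∷ʳ b , ≤-reflexive (sym (length-∷ʳ b u)) ,
        Equivalence.from (completeReturn⇔ u b)
          (ru , prefix-closed (u ∷ʳ b) v (subst S (sym (∷ʳ-++ u b v)) ubv∈S) , o′)
  ... | no ¬o′ =
    let ubv∈S′ = subst S (sym (∷ʳ-++ u b v)) ubv∈S
        y , lt , cr = next-return (u ∷ʳ b) v (rooted-∷ʳ ru (prefix-closed (u ∷ʳ b) v ubv∈S′) ¬o′) ubv∈S′
                        (subst (Occurs ∘ drop 1) (sym (∷ʳ-++ u b v)) o)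
    in y , ≤-trans (s≤s (≤-trans (n≤1+n _) (≤-reflexive (sym (length-∷ʳ b u))))) lt , cr

  -- Recurrence puts some `u ++ v ++ x` in `S`. As `u` is nonempty, the final `x` starts after the
  -- first letter.
  rooted⇒return : ∀ {u} → Rooted u → ∃ λ y → length u < length y × CompleteReturn S x y
  rooted⇒return {u} ru@(u∈S , pre , _) with t , refl ← IsPrefix⇒++ pre
    with v , _ , uvx∈S ← recur u∈S x∈S =
    next-return (x ++ t) (v ++ x) ru uvx∈S
      (subst Occurs (++-assoc (x′ ++ t) v x) (occurs-suffix ((x′ ++ t) ++ v)))

  -- Descent of Q and the final count

  Q-antitone : ∀ d e → Q (e + (d + length x′)) ≤ Q (d + length x′)
  Q-antitone d zero    = ≤-refl
  Q-antitone d (suc e) = ≤-trans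
    (subst (Q (suc e + (d + length x′)) ≤_) (sym (Q-step _ (≤-trans (m≤n+m _ d) (m≤n+m _ e)))) (m≤m+n _ _))
    (Q-antitone d e)

  -- Descent on the bound `q`: any rooted word of the given length extends to a complete return, and
  -- `Q` drops strictly at the level of that return.
  rootless-level : ∀ q d → Q (d + length x′) ≤ q →
    ∃ λ d → ∀ {u} → Rooted u → length u ≢ suc (d + length x′)
  rootless-level q d Q≤q with any? rooted? (words (suc (d + length x′)))
  ... | no none = d , λ {u} ru eq → none (lose (subst (λ k → u ∈ words k) eq (∈words u)) ru)
  ... | yes some with u , u∈ , ru ← find some with y , lt , cr ← rooted⇒return ru = descend q Q≤q
    where
    k = d + length x′

    -- Complete returns of length `suc (suc m)` are what `Q` loses from `m` to `suc m`, so `y` is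
    -- counted at `m = e + k`.
    e : ℕ
    e = length y ∸ suc (suc k)

    length-y : length y ≡ suc (suc (e + k))
    length-y = begin
      length y              ≡⟨ m∸n+n≡m (subst (_< length y) (∈words⇒length (suc k) u∈) lt) ⟨
      e + suc (suc k)       ≡⟨ +-suc e (suc k) ⟩
      suc (e + suc k)       ≡⟨ cong suc (+-suc e k) ⟩
      suc (suc (e + k))     ∎
      where open ≡-Reasoning

    drop-Q : Q (suc (e + k)) < Q k
    drop-Q = begin-strict
      Q (suc (e + k))
        <⟨ m<m+n _ {#returns (suc (suc (e + k)))} (subst (_≤ #returns (suc (suc (e + k)))) (𝟙-yes (completeReturn? y) cr)
             (∈⇒≤∑ (𝟙 ∘ completeReturn?) (subst (λ m → y ∈ words m) length-y (∈words y)))) ⟩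
      Q (suc (e + k)) + #returns (suc (suc (e + k)))
        ≡⟨ Q-step (e + k) (≤-trans (m≤n+m _ d) (m≤n+m _ e)) ⟨
      Q (e + k)
        ≤⟨ Q-antitone d e ⟩
      Q k ∎
      where open ≤-Reasoning

    descend : ∀ q → Q k ≤ q → ∃ λ d → ∀ {u} → Rooted u → length u ≢ suc (d + length x′)
    descend zero    le = contradiction (≤-trans drop-Q le) λ ()
    descend (suc q) le = rootless-level q (suc (e + d))
      (subst (λ m → Q (suc m) ≤ q) (sym (+-assoc e d (length x′))) (≤-pred (≤-trans drop-Q le)))

  -- Beyond a level without rooted words there are none either, which bounds the length of complete
  -- returns. There `Q` is zero, so `balance` has counted them all.
  completeReturns : HasCard (CompleteReturn S x) (suc (ρ []))
  completeReturns with d , rootless ← rootless-level _ zero ≤-refl =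
    HasCard-resp-⇔ (λ y → mk⇔ proj₂ (λ cr → length⇒∈upto (suc k) (bounded cr) , cr))
      (subst (HasCard _) total (∑-HasCard completeReturn? (!upto (suc k))))
    where
    k = d + length x′

    short : ∀ {u} → Rooted u → length u ≤ k
    short {u} ru with length u ≤? k
    ... | yes le = le
    ... | no ≰ with v , eq , rv ← rooted-at-level (suc k) (s≤s (m≤n+m _ d)) (≰⇒> ≰) ru =
      contradiction eq (rootless rv)

    bounded : ∀ {y} → CompleteReturn S x y → length y ≤ suc k
    bounded {y} cr with initLast y
    ... | []      = z≤n
    ... | u ∷ʳ′ b = subst (_≤ suc k) (sym (length-∷ʳ b u))
                      (s≤s (short (proj₁ (Equivalence.to (completeReturn⇔ u b) cr))))

    -- Recurrence places `x` somewhere before `w`; starting from its last occurrence gives a rooted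
    -- word longer than `k`.
    no-avoiding : ∀ {w} → w ∈ words k → ¬ Avoiding w
    no-avoiding {w} w∈ (w∈S , ¬o) with v , _ , xvw∈S ← recur x∈S w∈S
      with u , lt , ru ← last-occurrence (x ++ v) w ¬o
             (subst Occurs (sym (++-assoc x v w)) (++⇒Occurs [] (v ++ w)))
             (subst S (sym (++-assoc x v w)) xvw∈S)
      = <⇒≱ lt (≤-trans (short ru) (≤-reflexive (sym (∈words⇒length k w∈))))

    Q≡0 : Q k ≡ 0
    Q≡0 = cong₂ _+_
      (∑-zero (words k) (λ {w} w∈ → cong (_* ρ w) (𝟙-no (avoiding? w) (no-avoiding w∈))))
      (∑-zero (words (suc k)) (λ {w} w∈ → 𝟙-no (rooted? w) (λ rw → rootless rw (∈words⇒length (suc k) w∈))))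

    total : ∑ (upto (suc k)) (𝟙 ∘ completeReturn?) ≡ suc (ρ [])
    total = trans (sym (+-identityʳ _)) (trans (cong (∑ (upto (suc k)) (𝟙 ∘ completeReturn?) +_) (sym Q≡0)) (balance d))

  -- Every complete return starts with `x`, and removing this prefix is injective; `length-as`
  -- expresses `ρ []` by the size of the alphabet.
  rightReturns : HasCard (RightReturn S x) (suc (length as) ∸ c)
  rightReturns = subst (HasCard (RightReturn S x))
    (sym (trans (cong (λ m → suc m ∸ c) length-as) (m+n∸n≡m (suc (ρ [])) c)))
    (HasCard-preimage (x ++_) (λ {v} {w} → ++-cancelˡ x v w)
      (λ cr → let v , _ , eq = CompleteReturn.proper-prefix cr in v , eq)
      completeReturns)

-- Specular sets

theorem6p6 : {A : Set} {n : ℕ} → A ↔ Fin n →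
    (θ : A → A) → Involutive _≡_ θ →
    (S : Pred (List A) 0ℓ) → Specular θ S → Recurrent S →
    (x : List A) → S x → x ≢ [] →
    HasCard (RightReturn S x) (n ∸ 1)
theorem6p6 A↔Fin θ _ S spec rec []        x∈S x≢[] = contradiction refl x≢[]
theorem6p6 {A} {n} A↔Fin θ _ S spec rec (x₀ ∷ x′) x∈S _ =
  -- A specular set has characteristic 2, and `suc m ∸ 2` computes to `m ∸ 1`.
  subst (λ m → HasCard (RightReturn S (x₀ ∷ x′)) (suc m ∸ 2)) 
    (trans (length-map from (allFin n)) (length-tabulate {n = n} id))
    (Returns.rightReturns _≟_ (map from (allFin n))
      (Unique.map⁺ from-injective (Unique.allFin⁺ n))
      (λ a → subst (_∈ map from (allFin n)) (strictlyInverseʳ a) (∈-map⁺ from (∈-allFin (to a))))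
      (Specular.treeSet spec) rec x₀ x′ x∈S)
  where
  open Inverse A↔Fin using (to; from; strictlyInverseˡ; strictlyInverseʳ)

  from-injective : ∀ {i j} → from i ≡ from j → i ≡ j
  from-injective {i} {j} eq = trans (sym (strictlyInverseˡ i)) (trans (cong to eq) (strictlyInverseˡ j))

  _≟_ : DecidableEquality A
  _≟_ = inj⇒≟ (↔⇒↣ A↔Fin)
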